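{- Let $G$ be a graph and $B$ a PSD forcing set of $G$. Let $\mathcal F$ be a relaxed chronology of PSD forces for $B$ on $G$, and let $\mathcal Q$ be the path bundle of $\mathcal F$ induced by a vertex $x\in V(G)$. Then $\operatorname{Term}(\mathcal F|_{\mathcal Q})$ is a PSD forcing set of $G$. Furthermore, a relaxed chronology of PSD forces for $\operatorname{Term}(\mathcal F|_{\mathcal Q})$ on $G$ can be constructed by reversing the forces between vertices in $\mathcal Q$ and preserving all remaining forces; that is, there is a relaxed chronology of PSD forces for $\operatorname{Term}(\mathcal F|_{\mathcal Q})$ whose underlying set of forces consists of the reversals $v\to u$ of all forces $u\to v$ in $\mathcal F|_{\mathcal Q}$ together with all forces of $\mathcal F$ not in $\mathcal F|_{\mathcal Q}$.
   Context: All graphs are finite, simple and undirected. Each vertex is blue or white. PSD rule: if $B$ is the current set of blue vertices, $C$ is a component of $G-B$, and $u\in B$ satisfies $N_G(u)\cap V(C)=\{v\}$, then $u$ can force $v$ to become blue ($u\to v$). $B$ is a PSD forcing set if, starting with exactly $B$ blue, repeated forcing turns all vertices blue. $S_+(G,B)$ is the set of PSD forces $v\to u$ valid when exactly $B$ is blue. Relaxed chronology of PSD forces for a PSD forcing set $B$ on $G$: an ordered family $\mathcal F=\{F^{(k)}\}_{k=1}^K$ of sets of forces ($F^{(k)}=\emptyset$ allowed) such that, with $E_{\mathcal F}^{[0]}=E_{\mathcal F}^{(0)}=B$, $E_{\mathcal F}^{(k)}=\{u: v\to u\in F^{(k)}\text{ for some }v\}$, $E_{\mathcal F}^{[k]}=\bigcup_{j=0}^kE_{\mathcal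 F}^{(j)}$: (1) $F^{(k)}\subseteq S_+(G,E_{\mathcal F}^{[k-1]})$ for all $k$; (2) $v_1\to u,v_2\to u\in F^{(k)}$ implies $v_1=v_2$; (3) $E_{\mathcal F}^{[K]}=V(G)$. Its underlying set of forces is $\bigcup_kF^{(k)}$. For $x\in V(G)$, $\operatorname{rd}(x)$ is the unique $k$ with $x\in E_{\mathcal F}^{(k)}$. Path bundle of $\mathcal F$ induced by $x$: for $0\le k\le\operatorname{rd}(x)-1$ let $C_x^k$ be the component of $G-E_{\mathcal F}^{[k]}$ containing $x$. Let $B=\{v_i^0\}_{i=1}^{|B|}$ and let $Q_i^{[0]}$ be the one-vertex path on $v_i^0$. For each $i$, if $v_i^k\to w\in F^{(k+1)}$ for some $w\in V(C_x^k)$, put $v_i^{k+1}=w$ and obtain $Q_i^{[k+1]}$ by appending $w$ to the end of $Q_i^{[k]}$; otherwise put $v_i^{k+1}=v_i^k$ and $Q_i^{[k+1]}=Q_i^{[k]}$. The induced path bundle is $\mathcal Q=\{Q_i^{[\operatorname{rd}(x)]}\}_{i=1}^{|B|}$. Let $H$ be the subgraph of $G$ induced by the union of the vertex sets of the paths in $\mathcal Q$. $\mathcal F|_{\mathcal Q}=\mathcal F|_H$ is the family $\{F^{(k)}|_H\}_{k=1}^K$, where $F^{(k)}|_H=\{v\to u\in F^{(k)}:u,v\in V(H)\}$. $\operatorname{Term}(\mathcal F|_{\mathcal Q})$ is the set of vertices of $H$ that perform no force in $\mathcal F|_{\mathcal Q}$. -}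

module Defs where

open import Level using (0ℓ)
open import Data.Nat.Base as ℕ using (ℕ; suc; s≤s)
open import Data.Fin.Base using (Fin; zero; suc; toℕ; fromℕ; inject₁; _≤_; _<_)
open import Data.Fin.Properties using (<-cmp; toℕ-inject₁)
open import Data.List.Base using (List; [_]; _∷ʳ_)
import Data.List.Membership.Propositional as List
open import Data.Product.Base using (∃; ∃-syntax; _×_; _,_; proj₁; proj₂)
open import Data.Empty using (⊥; ⊥-elim)
open import Function.Bundles using (_⇔_; Equivalence)
open import Relation.Nullary using (¬_)
open import Relation.Unary as Unary using (Pred; _∈_; _∉_; _∪_; ｛_｝)
open import Relation.Binary.Core using (Rel)
import Relation.Binary.Definitions as Binary
open import Relation.Binary.Definitions using (Symmetric; tri<; tri≈; tri>)
open import Relation.Binary.Construct.Closure.ReflexiveTransitive using (Star; ε; _◅_)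
open import Relation.Binary.PropositionalEquality using (_≡_; refl; sym; subst)

record Graph (n : ℕ) : Set₁ where
  field
    Adj    : Rel (Fin n) 0ℓ
    adj?   : Binary.Decidable Adj
    symm   : Symmetric Adj
    irrefl : ∀ {v} → ¬ Adj v v

VertexSet : ℕ → Set₁
VertexSet n = Pred (Fin n) 0ℓ

-- A set of forces: φ v u means that the force v → u belongs to φ.
ForceSet : ℕ → Set₁
ForceSet n = Rel (Fin n) 0ℓ

module _ {n : ℕ} (G : Graph n) where
  open Graph G

  -- Adjacency in G − B.
  DeletedAdj : VertexSet n → Rel (Fin n) 0ℓ
  DeletedAdj B u v = u ∉ B × v ∉ B × Adj u v

  -- The vertex set of the component of G − B containing w; it is empty when
  -- w is in B.
  Component : VertexSet n → Fin n → VertexSet n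
  Component B w z = w ∉ B × Star (DeletedAdj B) w z

  -- PSDForce B is S₊(G, B).  A component C of G − B is given by one of its
  -- vertices w, and the last clause says N(u) ∩ V(C) = {v}.
  PSDForce : VertexSet n → ForceSet n
  PSDForce B u v =
    u ∈ B × ∃[ w ] (w ∉ B × (∀ z → (Adj u z × z ∈ Component B w) ⇔ (z ≡ v)))

  data ForcesAll (B : VertexSet n) : Set where
    done  : (∀ v → v ∈ B) → ForcesAll B
    force : ∀ {u v} → PSDForce B u v → ForcesAll (B ∪ ｛ v ｝) → ForcesAll B

  -- Subsets of the finite vertex set are decidable predicates.
  IsPSDForcingSet : VertexSet n → Set
  IsPSDForcingSet B = Unary.Decidable B × ForcesAll B

-- Time steps 0, …, K are the elements of Fin (suc K).  A family F⁽¹⁾, …, F⁽ᴷ⁾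
-- is indexed by Fin K, so that F i is F⁽ᵏ⁾ for k = suc i : Fin (suc K), and
-- the preceding time step k − 1 is inject₁ i.
module _ {n K : ℕ} where

  -- E B F k is E⁽ᵏ⁾.
  E : VertexSet n → (Fin K → ForceSet n) → Fin (suc K) → VertexSet n
  E B F zero    = B
  E B F (suc i) = λ u → ∃[ v ] F i v u

  -- E≤ B F k is E⁽⁰⁾ ∪ … ∪ E⁽ᵏ⁾, that is, E with superscript [k].
  E≤ : VertexSet n → (Fin K → ForceSet n) → Fin (suc K) → VertexSet n
  E≤ B F k u = ∃[ j ] (j ≤ k × u ∈ E B F j)

  Underlying : (Fin K → ForceSet n) → ForceSet n
  Underlying F v u = ∃[ i ] F i v u

  Restrict : (Fin K → ForceSet n) → VertexSet n → (Fin K → ForceSet n)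
  Restrict F H i v u = F i v u × v ∈ H × u ∈ H

record RelaxedChronology {n : ℕ} (G : Graph n) (B : VertexSet n) : Set₁ where
  field
    K        : ℕ
    F        : Fin K → ForceSet n
    F?       : ∀ i → Binary.Decidable (F i)
    valid    : ∀ i {v u} → F i v u → PSDForce G (E≤ B F (inject₁ i)) v u
    unique   : ∀ i {v₁ v₂ u} → F i v₁ u → F i v₂ u → v₁ ≡ v₂
    complete : ∀ u → u ∈ E≤ B F (fromℕ K)

module _ {n : ℕ} {G : Graph n} {B : VertexSet n} (𝓕 : RelaxedChronology G B) where
  open RelaxedChronology 𝓕

  -- The time is read off the proof of complete; by rd-unique it does not depend
  -- on that proof.
  rd : Fin n → Fin (suc K)
  rd x = proj₁ (complete x)

  -- Trajectory x b k Q v: with b = vᵢ⁰ in B, the path Qᵢ at time k, listed from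
  -- its first vertex to its last, is Q, and vᵢᵏ is v.
  data Trajectory (x b : Fin n) : Fin (suc K) → List (Fin n) → Fin n → Set where
    start : b ∈ B → Trajectory x b zero [ b ] b
    move  : ∀ {i Q v w} → Trajectory x b (inject₁ i) Q v →
            F i v w → w ∈ Component G (E≤ B F (inject₁ i)) x →
            Trajectory x b (suc i) (Q ∷ʳ w) w
    stay  : ∀ {i Q v} → Trajectory x b (inject₁ i) Q v →
            (∀ w → F i v w → w ∉ Component G (E≤ B F (inject₁ i)) x) →
            Trajectory x b (suc i) Q v

  PathBundle : Fin n → Pred (List (Fin n)) 0ℓ
  PathBundle x Q = ∃[ b ] ∃[ v ] Trajectory x b (rd x) Q v

  BundleVertices : Fin n → VertexSet n
  BundleVertices x z = ∃[ Q ] (Q ∈ PathBundle x × z List.∈ Q)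

  BundleForces : Fin n → (Fin K → ForceSet n)
  BundleForces x = Restrict F (BundleVertices x)

  Term : Fin n → VertexSet n
  Term x v = v ∈ BundleVertices x × ¬ (∃[ u ] Underlying (BundleForces x) v u)

  private
    target-white : ∀ i {v u} → F i v u → u ∉ E≤ B F (inject₁ i)
    target-white i f with valid i f
    ... | _ , w , _ , N∩C with proj₂ (Equivalence.from (N∩C _) refl)
    ... | w∉ , walk = end w∉ walk
      where
      end : ∀ {S : VertexSet n} {a c} → a ∉ S → Star (DeletedAdj G S) a c → c ∉ S
      end a∉ ε                   = a∉
      end _  ((_ , b∉ , _) ◅ bc) = end b∉ bc

    disjoint : ∀ {x j k} → j < k → x ∈ E B F j → x ∈ E B F k → ⊥
    disjoint {k = suc i} (s≤s j≤i) x∈Eⱼ (_ , f) =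
      target-white i f (_ , subst (_ ℕ.≤_) (sym (toℕ-inject₁ i)) j≤i , x∈Eⱼ)

  rd-unique : ∀ {x k} → x ∈ E B F k → k ≡ rd x
  rd-unique {x} {k} x∈ with <-cmp k (rd x)
  ... | tri< k<r _ _ = ⊥-elim (disjoint k<r x∈ (proj₂ (proj₂ (complete x))))
  ... | tri≈ _ k≡r _ = k≡r
  ... | tri> _ _ r<k = ⊥-elim (disjoint r<k (proj₂ (proj₂ (complete x))) x∈)

{-# OPTIONS --safe #-}

-- A blue vertex of G that still has a neighbour in C_x^k is the current end
-- v_i^k of a path: once a path vertex has forced into the component of x, it has
-- no other neighbour there.  Hence, when the blue vertices are the v_i^l with
-- l > k, the white part of C_x^k is cut off from the rest of the graph, and
-- v_i^(k+1) ∈ C_x^k has v_i^k as its only white neighbour in the component of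
-- v_i^k.  So the forces of step k + 1 inside the bundle can be reversed, for
-- k + 1 = K, …, 1.  Afterwards all of H is blue, and the remaining forces of F
-- keep their times: their targets lie outside H, and PSD forces stay valid when
-- the blue set grows, as long as the target stays white.

module Submission where

open import Defs
open import Data.Nat.Base as ℕ using (ℕ; z≤n; s≤s)
import Data.Nat.Properties as ℕ
open import Data.Empty using (⊥-elim)
open import Data.Fin.Base using (Fin; zero; suc; toℕ; fromℕ; inject₁; _≤_; _<_)
open import Data.Fin.Induction
  using (<-weakInduction; <-weakInduction-startingFrom; >-weakInduction)
open import Data.Fin.Properties
  using (_≟_; any?; toℕ-inject₁; ≤fromℕ; ≤-antisym; ≤-total; <-cmp;
         inject₁-injective; ≤∧≢⇒<; suc-injective)
  renaming (_≤?_ to _≤ᶠ?_)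
open import Data.List.Base using (List; []; _∷_; allFin)
import Data.List.Membership.Propositional as List
open import Data.List.Membership.Propositional.Properties
  using (∈-++⁺ˡ; ∈-++⁺ʳ; ∈-++⁻; ∈-allFin)
open import Data.List.Relation.Unary.Any as Any using (here; there)
open import Data.List.Relation.Unary.Any.Properties using (¬Any[])
open import Data.Product.Base
  using (∃-syntax; Σ-syntax; _×_; _,_; proj₁; proj₂; uncurry)
open import Data.Sum.Base using (_⊎_; inj₁; inj₂; [_,_]′)
import Data.Sum.Base as Sum
import Data.Vec.Functional as Vector
open import Function.Base using (_∘_; id)
open import Function.Bundles using (_⇔_; mk⇔; Equivalence)
open import Level using (0ℓ)
open import Relation.Binary.Core using (Rel)
import Relation.Binary.Definitions as Binary
open import Relation.Binary.Definitions using (tri<; tri≈; tri>)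
open import Relation.Binary.Construct.Closure.ReflexiveTransitive as Star
  using (Star; ε; _◅_; _◅◅_)
open import Relation.Binary.PropositionalEquality
  using (_≡_; refl; sym; trans; subst)
open import Relation.Nullary using (¬_; yes; no)
open import Relation.Nullary.Decidable using (decidable-stable; map′; ¬?; _×-dec_; _⊎-dec_)
open import Relation.Unary as Unary using (_∈_; _∉_; _⊆_; _≐_; _∪_; ｛_｝)
open RelaxedChronology

private
  variable
    n : ℕ

-- Decidability of reachability.

module _ {R : Rel (Fin n) 0ℓ} where

  -- Warshall's relation: a reaches b with all intermediate vertices in L.
  Via : List (Fin n) → Rel (Fin n) 0ℓ
  Via []      a b = a ≡ b ⊎ R a b
  Via (m ∷ L) a b = Via L a b ⊎ Via L a m × Via L m b

  via? : Binary.Decidable R → ∀ L → Binary.Decidable (Via L)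
  via? R? []      a b = (a ≟ b) ⊎-dec R? a b
  via? R? (m ∷ L) a b = via? R? L a b ⊎-dec (via? R? L a m ×-dec via? R? L m b)

  via⇒star : ∀ L {a b} → Via L a b → Star R a b
  via⇒star []      (inj₁ refl)    = ε
  via⇒star []      (inj₂ ab)      = ab ◅ ε
  via⇒star (m ∷ L) (inj₁ p)       = via⇒star L p
  via⇒star (m ∷ L) (inj₂ (p , q)) = via⇒star L p ◅◅ via⇒star L q

  via-base : ∀ L {a b} → a ≡ b ⊎ R a b → Via L a b
  via-base []      p = p
  via-base (_ ∷ L) p = inj₁ (via-base L p)

  -- Cut the walk at its first visit to `m`; `via-last` cuts at the last visit.
  via-first : ∀ L {m a} → Via (m ∷ L) a m → Via L a m
  via-first L = [ id , proj₁ ]′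

  via-last : ∀ L {m b} → Via (m ∷ L) m b → Via L m b
  via-last L = [ id , proj₂ ]′

  via-trans : ∀ {L a m b} → m List.∈ L → Via L a m → Via L m b → Via L a b
  via-trans {m ∷ L} (here refl) p q = inj₂ (via-first L p , via-last L q)
  via-trans (there m∈) (inj₁ p)       (inj₁ q)       = inj₁ (via-trans m∈ p q)
  via-trans (there m∈) (inj₁ p)       (inj₂ (q , s)) = inj₂ (via-trans m∈ p q , s)
  via-trans (there m∈) (inj₂ (p , r)) (inj₁ q)       = inj₂ (p , via-trans m∈ r q)
  -- Both walks visit the head of the list, so the closed part between the two visits is cut out.
  via-trans (there m∈) (inj₂ (p , _)) (inj₂ (_ , s)) = inj₂ (p , s)

  star⇒via : ∀ {a b} → Star R a b → Via (allFin n) a b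
  star⇒via ε         = via-base (allFin n) (inj₁ refl)
  star⇒via (ac ◅ cb) =
    via-trans (∈-allFin _) (via-base (allFin n) (inj₂ ac)) (star⇒via cb)

  star? : Binary.Decidable R → Binary.Decidable (Star R)
  star? R? a b = map′ (via⇒star (allFin n)) star⇒via (via? R? (allFin n) a b)

-- Arithmetic of time steps.

suc≰inject₁ : (i : Fin n) → ¬ (suc i ≤ inject₁ i)
suc≰inject₁ i p = ℕ.<-irrefl refl (subst (toℕ i ℕ.<_) (toℕ-inject₁ i) p)

≰inject₁⇒suc≤ : (i : Fin n) {j : Fin (ℕ.suc n)} → ¬ (j ≤ inject₁ i) → suc i ≤ j
≰inject₁⇒suc≤ i j≰i = subst (ℕ._< _) (toℕ-inject₁ i) (ℕ.≰⇒> j≰i)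

<⇒suc≤inject₁ : {i j : Fin n} → i < j → suc i ≤ inject₁ j
<⇒suc≤inject₁ {i = i} {j} = subst (ℕ.suc (toℕ i) ℕ.≤_) (sym (toℕ-inject₁ j))

inject₁-mono : {i j : Fin n} → i ≤ j → inject₁ i ≤ inject₁ j
inject₁-mono {i = i} {j} i≤j rewrite toℕ-inject₁ i | toℕ-inject₁ j = i≤j

inject₁≤suc : (i : Fin n) → inject₁ i ≤ suc i
inject₁≤suc i = subst (ℕ._≤ toℕ (suc i)) (sym (toℕ-inject₁ i)) (ℕ.n≤1+n (toℕ i))

blue-start : ∀ {K} {S : VertexSet n} {F : Fin K → ForceSet n} → E≤ S F zero ⊆ S
blue-start (zero , z≤n , u∈) = u∈

-- Components and PSD forces.

module _ (G : Graph n) where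
  open Graph G

  module _ {S : VertexSet n} where

    walk-white : ∀ {a b} → a ∉ S → Star (DeletedAdj G S) a b → b ∉ S
    walk-white a∉ ε                   = a∉
    walk-white _  ((_ , c∉ , _) ◅ cb) = walk-white c∉ cb

    component-white : ∀ {w z} → z ∈ Component G S w → z ∉ S
    component-white (w∉ , wz) = walk-white w∉ wz

    component-extend : ∀ {w y z} → y ∈ Component G S w → Adj y z → z ∉ S →
                       z ∈ Component G S w
    component-extend y∈@(w∉ , wy) yz z∉ =
      w∉ , wy ◅◅ (component-white y∈ , z∉ , yz) ◅ ε

    walk-sym : ∀ {a b} → Star (DeletedAdj G S) a b → Star (DeletedAdj G S) b a
    walk-sym = Star.reverse λ (a∉ , b∉ , ab) → b∉ , a∉ , symm ab

    component? : Unary.Decidable S → ∀ w → Unary.Decidable (Component G S w)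
    component? S? w z = ¬? (S? w) ×-dec star? deletedAdj? w z
      where
      deletedAdj? : Binary.Decidable (DeletedAdj G S)
      deletedAdj? a b = ¬? (S? a) ×-dec ¬? (S? b) ×-dec adj? a b

    psdForce : ∀ {u v} → u ∈ S → v ∉ S → Adj u v →
               (∀ {z} → Adj u z → z ∈ Component G S v → z ≡ v) →
               PSDForce G S u v
    psdForce u∈ v∉ uv sole =
      u∈ , _ , v∉ , λ z → mk⇔ (uncurry sole) λ { refl → uv , v∉ , ε }

    force-adj : ∀ {u v} → PSDForce G S u v → Adj u v
    force-adj (_ , _ , _ , N∩C) = proj₁ (Equivalence.from (N∩C _) refl)

    force-white : ∀ {u v} → PSDForce G S u v → v ∉ S
    force-white (_ , _ , _ , N∩C) =
      component-white (proj₂ (Equivalence.from (N∩C _) refl))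

    -- The component named in the force and that of `w` share `v`, so they coincide.
    force-sole : ∀ {u v w z} → PSDForce G S u v → v ∈ Component G S w →
                 z ∈ Component G S w → Adj u z → z ≡ v
    force-sole (_ , _ , _ , N∩C) (_ , wv) (_ , wz) uz
      with _ , w′∉ , w′v ← Equivalence.from (N∩C _) refl =
      Equivalence.to (N∩C _) (uz , w′∉ , w′v ◅◅ walk-sym wv ◅◅ wz)

  component-antitone : ∀ {S T : VertexSet n} {w} → S ⊆ T →
                       Component G T w ⊆ Component G S w
  component-antitone S⊆T (w∉ , wz) =
    w∉ ∘ S⊆T , Star.map (λ (a∉ , b∉ , ab) → a∉ ∘ S⊆T , b∉ ∘ S⊆T , ab) wz

  -- Components shrink as the blue set grows, so no second white neighbour can appear.
  psdForce-mono : ∀ {S T : VertexSet n} {u v} → S ⊆ T → v ∉ T →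
                  PSDForce G S u v → PSDForce G T u v
  psdForce-mono S⊆T v∉T f =
    psdForce (S⊆T (proj₁ f)) v∉T (force-adj f) λ uz z∈ →
      force-sole f (force-white f , ε) (component-antitone S⊆T z∈) uz

-- Blue sets of a relaxed chronology.

module _ {G : Graph n} {B : VertexSet n} (𝓕 : RelaxedChronology G B) where

  private
    Blue : Fin (ℕ.suc (K 𝓕)) → VertexSet n
    Blue = E≤ B (F 𝓕)

  blue⇒rd≤ : ∀ {k u} → u ∈ Blue k → rd 𝓕 u ≤ k
  blue⇒rd≤ (_ , j≤k , u∈) = subst (_≤ _) (rd-unique 𝓕 u∈) j≤k

  rd≤⇒blue : ∀ {k u} → rd 𝓕 u ≤ k → u ∈ Blue k
  rd≤⇒blue {u = u} r≤k = rd 𝓕 u , r≤k , proj₂ (proj₂ (complete 𝓕 u))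

  blue? : ∀ k → Unary.Decidable (Blue k)
  blue? k u = map′ rd≤⇒blue blue⇒rd≤ (rd 𝓕 u ≤ᶠ? k)

  blue-mono : ∀ {j k} → j ≤ k → Blue j ⊆ Blue k
  blue-mono j≤k (i , i≤j , u∈) = i , ℕ.≤-trans i≤j j≤k , u∈

  start⊆blue : ∀ {k} → B ⊆ Blue k
  start⊆blue b∈ = zero , z≤n , b∈

  -- The starting set consists of the vertices with `rd` zero. Applied to the reversed chronology,
  -- this decides `Term`.
  initial? : Unary.Decidable B
  initial? u = map′ (blue-start {F = F 𝓕}) start⊆blue (blue? zero u)

  target-blue : ∀ {i v u} → F 𝓕 i v u → u ∈ Blue (suc i)
  target-blue f = _ , ℕ.≤-refl , _ , f

  blue-split : ∀ {i u} → u ∈ Blue (suc i) → u ∈ Blue (inject₁ i) ⊎ ∃[ v ] F 𝓕 i v u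
  blue-split {i} {u} u∈ with blue? (inject₁ i) u | u∈
  ... | yes u∈′ | _                   = inj₁ u∈′
  ... | no u∉   | zero , _ , b∈       = ⊥-elim (u∉ (start⊆blue b∈))
  ... | no u∉   | suc j , j≤i , v , f with <-cmp j i
  ...   | tri< j<i _ _  = ⊥-elim (u∉ (suc j , <⇒suc≤inject₁ j<i , v , f))
  ...   | tri≈ _ refl _ = inj₂ (v , f)
  ...   | tri> _ _ i<j  = ⊥-elim (ℕ.≤⇒≯ (ℕ.s≤s⁻¹ j≤i) i<j)

  time-unique : ∀ {i j v w u} → F 𝓕 i v u → F 𝓕 j w u → i ≡ j
  time-unique f g =
    suc-injective (trans (rd-unique 𝓕 (_ , f)) (sym (rd-unique 𝓕 (_ , g))))

  source-time : ∀ {i j u v w} → F 𝓕 i u v → F 𝓕 j v w → suc i ≤ inject₁ j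
  source-time {i} {j} f g = subst (_≤ inject₁ j) (sym (rd-unique 𝓕 (_ , f)))
    (blue⇒rd≤ (proj₁ (valid 𝓕 j g)))

  -- The forces of one time step are carried out one by one, so the induction has to allow any
  -- decidable blue set containing `Blue k`.
  forcesAll : ForcesAll G B
  forcesAll = >-weakInduction P (λ S _ E⊆S → done λ v → E⊆S (complete 𝓕 v)) step
    zero B initial? (blue-start {F = F 𝓕})
    where
    P : Fin (ℕ.suc (K 𝓕)) → Set₁
    P k = ∀ S → Unary.Decidable S → Blue k ⊆ S → ForcesAll G S

    step : ∀ i → P (suc i) → P (inject₁ i)
    step i next S₀ S₀? E⊆S₀ = sweep (allFin n) S₀ S₀? E⊆S₀ λ _ _ → ∈-allFin _
      where
      -- `L` is a worklist containing every target of this step that is still white.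
      sweep : ∀ L S → Unary.Decidable S → Blue (inject₁ i) ⊆ S →
              (∀ {z} → z ∈ E B (F 𝓕) (suc i) → z ∉ S → z List.∈ L) → ForcesAll G S
      sweep [] S S? E⊆S cover = next S S? λ {z} z∈ → decidable-stable (S? z) λ z∉ →
        [ z∉ ∘ E⊆S , (λ z∈E → ¬Any[] (cover z∈E z∉)) ]′ (blue-split z∈)
      sweep (u ∷ L) S S? E⊆S cover with S? u | any? (λ v → F? 𝓕 i v u)
      ... | yes u∈S | _ = sweep L S S? E⊆S λ z∈ z∉ →
        Any.tail (λ { refl → z∉ u∈S }) (cover z∈ z∉)
      ... | no u∉S | yes (v , f) = force (psdForce-mono G E⊆S u∉S (valid 𝓕 i f))
        (sweep L (S ∪ ｛ u ｝) (λ z → S? z ⊎-dec (u ≟ z)) (inj₁ ∘ E⊆S) λ z∈ z∉ →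
          Any.tail (λ { refl → z∉ (inj₂ refl) }) (cover z∈ (z∉ ∘ inj₁)))
      ... | no _ | no unforced = sweep L S S? E⊆S λ z∈ z∉ →
        Any.tail (λ { refl → unforced z∈ }) (cover z∈ z∉)

  -- Building new chronologies from old ones.

  relabel : ∀ {S} → B ≐ S → RelaxedChronology G S
  relabel {S} (B⊆S , S⊆B) = record
    { K        = K 𝓕
    ; F        = F 𝓕
    ; F?       = F? 𝓕
    ; valid    = λ i f → psdForce-mono G (to _) (force-white G (valid 𝓕 i f) ∘ from _) (valid 𝓕 i f)
    ; unique   = unique 𝓕
    ; complete = λ u → to _ (complete 𝓕 u)
    }
    where
    to : ∀ k → Blue k ⊆ E≤ S (F 𝓕) k
    to k (zero  , j≤k , u∈) = zero , j≤k , B⊆S u∈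
    to k (suc j , j≤k , u∈) = suc j , j≤k , u∈

    from : ∀ k → E≤ S (F 𝓕) k ⊆ Blue k
    from k (zero  , j≤k , u∈) = zero , j≤k , S⊆B u∈
    from k (suc j , j≤k , u∈) = suc j , j≤k , u∈

  -- Forces into `S` are dropped. Any other target is still white at its time, since it is forced at
  -- that time only.
  enlarge : ∀ {S} → Unary.Decidable S → B ⊆ S → RelaxedChronology G S
  enlarge {S} S? B⊆S = record
    { K        = K 𝓕
    ; F        = F⁺
    ; F?       = λ i v u → F? 𝓕 i v u ×-dec ¬? (S? u)
    ; valid    = λ i (f , u∉S) → psdForce-mono G (blue⊆ _) (white f u∉S) (valid 𝓕 i f)
    ; unique   = λ i (f , _) (g , _) → unique 𝓕 i f g
    ; complete = λ u → blue⊆ _ (complete 𝓕 u)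
    }
    where
    F⁺ : Fin (K 𝓕) → ForceSet n
    F⁺ i v u = F 𝓕 i v u × u ∉ S

    blue⊆ : ∀ k → Blue k ⊆ E≤ S F⁺ k
    blue⊆ k {u} u∈ with S? u | u∈
    ... | yes u∈S | _                     = zero , z≤n , u∈S
    ... | no u∉S  | zero , _ , b∈         = ⊥-elim (u∉S (B⊆S b∈))
    ... | no u∉S  | suc j , j≤k , v , f   = suc j , j≤k , v , f , u∉S

    white : ∀ {i v u} → F 𝓕 i v u → u ∉ S → u ∉ E≤ S F⁺ (inject₁ i)
    white f u∉S (zero  , _ , u∈S)           = u∉S u∈S
    white {i} f u∉S (suc j , j≤i , w , g , _) with refl ← time-unique f g = suc≰inject₁ i j≤i

  -- The step `φ` turns `S` into exactly `B`, after which the old chronology runs one step later.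
  prepend : ∀ {S φ} → Binary.Decidable φ → (∀ {v u} → φ v u → PSDForce G S v u) →
            (∀ {v w u} → φ v u → φ w u → v ≡ w) →
            (λ u → u ∈ S ⊎ ∃[ v ] φ v u) ≐ B → RelaxedChronology G S
  prepend {S} {φ} φ? φ-valid φ-unique (S∪⊆B , B⊆S∪) = record
    { K        = ℕ.suc (K 𝓕)
    ; F        = F⁺
    ; F?       = λ { zero → φ? ; (suc i) → F? 𝓕 i }
    ; valid    = valid⁺
    ; unique   = λ { zero → φ-unique ; (suc i) → unique 𝓕 i }
    ; complete = λ u → to (complete 𝓕 u)
    }
    where
    F⁺ : Fin (ℕ.suc (K 𝓕)) → ForceSet n
    F⁺ = φ Vector.∷ F 𝓕

    to : ∀ {k} → Blue k ⊆ E≤ S F⁺ (suc k)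
    to (zero , _ , u∈) with B⊆S∪ u∈
    ... | inj₁ u∈S = zero , z≤n , u∈S
    ... | inj₂ u∈φ = suc zero , s≤s z≤n , u∈φ
    to (suc j , j≤k , u∈) = suc (suc j) , s≤s j≤k , u∈

    from : ∀ {k} → E≤ S F⁺ (suc k) ⊆ Blue k
    from (zero        , _       , u∈S) = start⊆blue (S∪⊆B (inj₁ u∈S))
    from (suc zero    , _       , u∈φ) = start⊆blue (S∪⊆B (inj₂ u∈φ))
    from (suc (suc j) , s≤s j≤k , u∈)  = suc j , j≤k , u∈

    valid⁺ : ∀ i {v u} → F⁺ i v u → PSDForce G (E≤ S F⁺ (inject₁ i)) v u
    valid⁺ zero    f = psdForce-mono G (λ u∈ → zero , z≤n , u∈)
      (force-white G (φ-valid f) ∘ blue-start {F = F⁺}) (φ-valid f)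
    valid⁺ (suc i) f =
      psdForce-mono G to (force-white G (valid 𝓕 i f) ∘ from) (valid 𝓕 i f)

-- The vertices of the path bundle.

module _ {G : Graph n} {B : VertexSet n} (𝓕 : RelaxedChronology G B) (x : Fin n) where
  open Graph G

  private
    Blue C : Fin (ℕ.suc (K 𝓕)) → VertexSet n
    Blue   = E≤ B (F 𝓕)
    C k    = Component G (Blue k) x

    H : VertexSet n
    H = BundleVertices 𝓕 x

    β : Fin (K 𝓕) → ForceSet n
    β = BundleForces 𝓕 x

  C? : ∀ k → Unary.Decidable (C k)
  C? k = component? G (blue? 𝓕 k) x

  C-antitone : ∀ {j k} → j ≤ k → C k ⊆ C j
  C-antitone j≤k = component-antitone G (blue-mono 𝓕 j≤k)

  C⇒suc≤rd : ∀ {i z} → z ∈ C (inject₁ i) → suc i ≤ rd 𝓕 x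
  C⇒suc≤rd {i} (x∉ , _) = ≰inject₁⇒suc≤ i (x∉ ∘ rd≤⇒blue 𝓕)

  trajectory-last : ∀ {b k Q v} → Trajectory 𝓕 x b k Q v → v List.∈ Q
  trajectory-last (start _)          = here refl
  trajectory-last (move {Q = Q} _ _ _) = ∈-++⁺ʳ Q (here refl)
  trajectory-last (stay t _)         = trajectory-last t

  -- A description of `H` without paths, which makes membership decidable.
  Visited : VertexSet n
  Visited z = z ∈ B ⊎ ∃[ i ] ∃[ v ] (F 𝓕 i v z × z ∈ C (inject₁ i))

  trajectory⊆visited : ∀ {b k Q v z} → Trajectory 𝓕 x b k Q v → z List.∈ Q → z ∈ Visited
  trajectory⊆visited (start b∈) (here refl) = inj₁ b∈
  trajectory⊆visited (move {Q = Q} t f w∈) z∈ with ∈-++⁻ Q z∈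
  ... | inj₁ z∈Q         = trajectory⊆visited t z∈Q
  ... | inj₂ (here refl) = inj₂ (_ , _ , f , w∈)
  trajectory⊆visited (stay t _) z∈ = trajectory⊆visited t z∈

  Through : Fin n → Fin (ℕ.suc (K 𝓕)) → Set
  Through z k = ∃[ b ] ∃[ Q ] ∃[ v ] (Trajectory 𝓕 x b k Q v × z List.∈ Q)

  -- Paths only grow, and a finite search decides between `move` and `stay`.
  through-mono : ∀ {z j k} → j ≤ k → Through z j → Through z k
  through-mono {z} j≤k t = <-weakInduction-startingFrom (Through z) t step j≤k
    where
    step : ∀ i → Through z (inject₁ i) → Through z (suc i)
    step i (b , Q , v , t , z∈) with any? (λ w → F? 𝓕 i v w ×-dec C? (inject₁ i) w)
    ... | yes (w , f , w∈) = b , _ , w , move t f w∈ , ∈-++⁺ˡ z∈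
    ... | no ¬move         = b , Q , v , stay t (λ w f w∈ → ¬move (w , f , w∈)) , z∈

  boundary : ∀ k {u c} → u ∈ Blue k → Adj u c → c ∈ C k →
             ∃[ b ] ∃[ Q ] Trajectory 𝓕 x b k Q u
  boundary k = <-weakInduction P base step k
    where
    P : Fin (ℕ.suc (K 𝓕)) → Set
    P k = ∀ {u c} → u ∈ Blue k → Adj u c → c ∈ C k →
          ∃[ b ] ∃[ Q ] Trajectory 𝓕 x b k Q u

    base : P zero
    base u∈ _ _ = _ , _ , start (blue-start {F = F 𝓕} u∈)

    step : ∀ i → P (inject₁ i) → P (suc i)
    step i rec {u} {c} u∈ uc c∈ = go (blue-split 𝓕 u∈)
      where
      c∈′ : c ∈ C (inject₁ i)
      c∈′ = C-antitone (inject₁≤suc i) c∈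

      go : u ∈ Blue (inject₁ i) ⊎ ∃[ v ] F 𝓕 i v u → _
      -- A force from `u` into the component would have target `c`, its neighbour there, but `c` is
      -- white after this step.
      go (inj₁ u∈′) with b , Q , t ← rec u∈′ uc c∈′ = b , Q , stay t λ w f w∈ →
        component-white G c∈ (subst (_∈ Blue (suc i))
          (sym (force-sole G (valid 𝓕 i f) w∈ c∈′ uc)) (target-blue 𝓕 f))
      -- Before the step, `u` was a white neighbour of `c`, hence in the component; so `v` bordered
      -- the component and was the end of a path.
      go (inj₂ (v , f)) =
        let p       = valid 𝓕 i f
            u∈C     = component-extend G c∈′ (symm uc) (force-white G p)
            b , Q , t = rec (proj₁ p) (force-adj G p) u∈C
        in b , _ , move t f u∈C

  visited⊆bundle : Visited ⊆ H
  visited⊆bundle (inj₁ b∈) with through-mono z≤n (_ , _ , _ , start b∈ , here refl)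
  ... | b , Q , v , t , z∈ = Q , (b , v , t) , z∈
  -- The path ending at `v` moves to `z`, no later than `rd x` because `x` was still white, and is
  -- then extended to that time.
  visited⊆bundle (inj₂ (i , v , f , z∈C))
    with b , _ , t ← boundary (inject₁ i) (proj₁ (valid 𝓕 i f)) (force-adj G (valid 𝓕 i f)) z∈C
    with b , Q , v , t , z∈ ← through-mono (C⇒suc≤rd z∈C)
           (_ , _ , _ , move t f z∈C , trajectory-last (move t f z∈C)) =
    Q , (b , v , t) , z∈

  bundle⊆visited : H ⊆ Visited
  bundle⊆visited (_ , (_ , _ , t) , z∈) = trajectory⊆visited t z∈

  bundle? : Unary.Decidable H
  bundle? z = map′ visited⊆bundle bundle⊆visited
    (initial? 𝓕 z ⊎-dec any? λ i → any? λ v → F? 𝓕 i v z ×-dec C? (inject₁ i) z)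

  boundary⊆bundle : ∀ {k u c} → u ∈ Blue k → Adj u c → c ∈ C k → u ∈ H
  boundary⊆bundle u∈ uc c∈ with _ , _ , t ← boundary _ u∈ uc c∈ =
    visited⊆bundle (trajectory⊆visited t (trajectory-last t))

  -- Forces inside the bundle.

  target∈C : ∀ {i v u} → F 𝓕 i v u → u ∈ H → u ∈ C (inject₁ i)
  target∈C {i} f u∈H with bundle⊆visited u∈H
  ... | inj₁ b∈ = ⊥-elim (force-white G (valid 𝓕 i f) (start⊆blue 𝓕 b∈))
  ... | inj₂ (_ , _ , g , u∈C) with refl ← time-unique 𝓕 f g = u∈C

  -- The source borders the component of `x`, so it lies on a path. Hence the forces outside the
  -- bundle are those with target outside `H`.
  force-into-bundle : ∀ {i v u} → F 𝓕 i v u → u ∈ H → β i v u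
  force-into-bundle {i} f u∈H =
    f , boundary⊆bundle (proj₁ p) (force-adj G p) (target∈C f u∈H) , u∈H
    where p = valid 𝓕 i f

  bundle-force? : ∀ i → Binary.Decidable (β i)
  bundle-force? i v u = F? 𝓕 i v u ×-dec bundle? v ×-dec bundle? u

  bundle-force-sole : ∀ {i v u c} → β i v u → c ∈ C (inject₁ i) → Adj v c → c ≡ u
  bundle-force-sole {i} (f , _ , u∈H) = force-sole G (valid 𝓕 i f) (target∈C f u∈H)

  bundle-force-adj : ∀ {i v u} → β i v u → Adj v u
  bundle-force-adj {i} (f , _) = force-adj G (valid 𝓕 i f)

  -- The later target also lies in the earlier, larger component, where the source has only one
  -- neighbour.
  bundle-target-unique : ∀ {i j v u w} → β i v u → β j v w → u ≡ w
  bundle-target-unique {i} {j} p@(f , _ , u∈) q@(g , _ , w∈) with ≤-total i j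
  ... | inj₁ i≤j = sym (bundle-force-sole p
                     (C-antitone (inject₁-mono i≤j) (target∈C g w∈)) (bundle-force-adj q))
  ... | inj₂ j≤i = bundle-force-sole q
                     (C-antitone (inject₁-mono j≤i) (target∈C f u∈)) (bundle-force-adj p)

  -- The vertices v_i^l with l ≥ k.
  Active : Fin (ℕ.suc (K 𝓕)) → VertexSet n
  Active k v = v ∈ H × (∀ {j u} → β j v u → k ≤ inject₁ j)

  bundle≐active : H ≐ Active zero
  bundle≐active = (λ v∈ → v∈ , λ _ → z≤n) , proj₁

  active≐term : Active (fromℕ (K 𝓕)) ≐ Term 𝓕 x
  active≐term =
    (λ (v∈ , late) → v∈ , λ (_ , i , p) →
      suc≰inject₁ i (ℕ.≤-trans (≤fromℕ (suc i)) (late p))) ,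
    (λ (v∈ , ¬p) → v∈ , λ p → ⊥-elim (¬p (_ , _ , p)))

  -- The condition of `prepend`: the targets of the reversed step are the sources of `β i`.
  active-step : ∀ i → (λ v → v ∈ Active (suc i) ⊎ ∃[ w ] β i v w) ≐ Active (inject₁ i)
  active-step i = to , from
    where
    to : (λ v → v ∈ Active (suc i) ⊎ ∃[ w ] β i v w) ⊆ Active (inject₁ i)
    to (inj₁ (v∈ , late)) = v∈ , λ p → ℕ.≤-trans (inject₁≤suc i) (late p)
    to (inj₂ (w , p@(f , v∈ , _))) = v∈ , λ q@(g , _) → same g (bundle-target-unique p q)
      where
      same : ∀ {j v u} → F 𝓕 j v u → w ≡ u → inject₁ i ≤ inject₁ j
      same g refl with refl ← time-unique 𝓕 f g = ℕ.≤-refl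

    from : Active (inject₁ i) ⊆ (λ v → v ∈ Active (suc i) ⊎ ∃[ w ] β i v w)
    from {v} (v∈ , late) with any? (bundle-force? i v)
    ... | yes p  = inj₂ p
    ... | no ¬p = inj₁ (v∈ , λ {j} q → ≰inject₁⇒suc≤ i λ j≤i →
      ¬p (_ , subst (λ k → β k v _) (inject₁-injective (≤-antisym j≤i (late q))) q))

  -- Reversing one time step.

  target-active : ∀ {i v u} → β i v u → u ∈ Active (suc i)
  target-active (f , _ , u∈) = u∈ , λ (g , _) → source-time 𝓕 f g

  -- If `b` is blue in `𝓕`, it borders the component and lies in the bundle. Being inactive, it has
  -- forced by step `suc i`, and only that very step leaves `a` white beforehand.
  frontier : ∀ {i a b} → a ∈ C (inject₁ i) → Adj a b → b ∉ Active (suc i) →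
             b ∈ C (inject₁ i) ⊎ β i b a
  frontier {i} {a} {b} a∈ ab b∉ with blue? 𝓕 (inject₁ i) b | any? (bundle-force? i b)
  ... | no b-white | _           = inj₁ (component-extend G a∈ ab b-white)
  ... | yes _      | yes (c , p) =
    inj₂ (subst (β i b) (sym (bundle-force-sole p a∈ (symm ab))) p)
  ... | yes b-blue | no ¬p       = ⊥-elim (b∉ ([ id , ⊥-elim ∘ ¬p ]′
    (proj₂ (active-step i) (boundary⊆bundle b-blue (symm ab) a∈ , late))))
    where
    late : ∀ {j u} → β j b u → inject₁ i ≤ inject₁ j
    -- An earlier force of `b` would have had target `a`, which is still white.
    late {j} q = decidable-stable (inject₁ i ≤ᶠ? inject₁ j) λ i≰j →
      let j<i = ≰inject₁⇒suc≤ j i≰j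
          a≡u = bundle-force-sole q
                  (C-antitone (ℕ.≤-trans (inject₁≤suc j) j<i) a∈) (symm ab)
      in component-white G a∈ (blue-mono 𝓕 j<i
           (subst (_∈ Blue (suc j)) (sym a≡u) (target-blue 𝓕 (proj₁ q))))

  -- No white walk leaves C_x^k: by frontier it would do so through a vertex
  -- v_j^k that moves at step k + 1, and its target is already blue.
  white-walk-in-C : ∀ {i a b} → a ∈ C (inject₁ i) →
                    Star (DeletedAdj G (Active (suc i))) a b → b ∈ C (inject₁ i)
  white-walk-in-C a∈ ε = a∈
  white-walk-in-C {i} a∈ ((a∉ , c∉ , ac) ◅ cb) with frontier {i} a∈ ac c∉
  ... | inj₁ c∈ = white-walk-in-C {i} c∈ cb
  ... | inj₂ p  = ⊥-elim (a∉ (target-active p))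

  -- By `frontier`, a white neighbour of `u` either forces `u`, so it is `v`, or lies in the
  -- component of `x`. In the latter case a white walk to `v` would put the blue vertex `v` in that
  -- component.
  reversed-valid : ∀ {i v u} → β i v u → PSDForce G (Active (suc i)) u v
  reversed-valid {i} {v} {u} p@(f , _ , u∈H) =
    psdForce G (target-active p) (λ (_ , late) → suc≰inject₁ i (late p))
      (symm (bundle-force-adj p)) sole
    where
    u∈C : u ∈ C (inject₁ i)
    u∈C = target∈C f u∈H

    sole : ∀ {z} → Adj u z → z ∈ Component G (Active (suc i)) v → z ≡ v
    sole uz z∈@(_ , vz) with frontier {i} u∈C uz (component-white G z∈)
    ... | inj₂ (g , _) = unique 𝓕 i g f
    ... | inj₁ z∈C     = ⊥-elim (component-white G
      (white-walk-in-C {i} z∈C (walk-sym G vz)) (proj₁ (valid 𝓕 i f)))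

  Reversal : Fin (ℕ.suc (K 𝓕)) → Set₁
  Reversal k = Σ[ 𝓖 ∈ RelaxedChronology G (Active k) ] (∀ v u → Underlying (F 𝓖) v u ⇔
    ((∃[ i ] (suc i ≤ k × β i u v)) ⊎ (∃[ i ] (F 𝓕 i v u × u ∉ H))))

  -- The induction goes up in `k` although the reversed steps run downwards in time, because each
  -- new one is put in front.
  reversal : ∀ k → Reversal k
  reversal = <-weakInduction Reversal base step
    where
    base : Reversal zero
    -- With all of `H` blue, only the forces into vertices outside `H` remain.
    base = relabel (enlarge 𝓕 bundle? (visited⊆bundle ∘ inj₁)) bundle≐active ,
      λ v u → mk⇔ inj₂ λ { (inj₁ (_ , () , _)) ; (inj₂ kept) → kept }

    step : ∀ i → Reversal (inject₁ i) → Reversal (suc i)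
    step i (𝓖 , forces) =
      prepend 𝓖 (λ u v → bundle-force? i v u) reversed-valid
        (λ p q → bundle-target-unique p q) (active-step i) ,
      λ v u → mk⇔ (to v u) (from v u)
      where
      to : ∀ v u → _ → _
      to v u (zero , p)  = inj₁ (i , ℕ.≤-refl , p)
      to v u (suc j , f) = Sum.map₁ (λ (l , l≤ , p) → l , ℕ.≤-trans l≤ (inject₁≤suc i) , p)
        (Equivalence.to (forces v u) (j , f))

      later : ∀ {v u} → Underlying (F 𝓖) v u → _
      later (j , f) = suc j , f

      from : ∀ v u → _ → _
      from v u (inj₂ kept) = later (Equivalence.from (forces v u) (inj₂ kept))
      from v u (inj₁ (j , j≤i , p)) with i ≟ j
      ... | yes refl = zero , p
      ... | no i≢j   = later (Equivalence.from (forces v u) (inj₁ (j ,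
        <⇒suc≤inject₁ (≤∧≢⇒< (ℕ.s≤s⁻¹ j≤i) (i≢j ∘ sym)) , p)))

theorem5p10 : ∀ {n : ℕ} (G : Graph n) (B : VertexSet n) → IsPSDForcingSet G B →
    (𝓕 : RelaxedChronology G B) (x : Fin n) →
    IsPSDForcingSet G (Term 𝓕 x) ×
    (Σ[ 𝓕′ ∈ RelaxedChronology G (Term 𝓕 x) ]
    (∀ v u → Underlying (F 𝓕′) v u ⇔
    (Underlying (BundleForces 𝓕 x) u v ⊎
    (Underlying (F 𝓕) v u × ¬ Underlying (BundleForces 𝓕 x) v u))))
theorem5p10 G B _ 𝓕 x =
  (initial? 𝓕′ , forcesAll 𝓕′) , 𝓕′ , λ v u → mk⇔
    (Sum.map (λ (i , _ , p) → i , p)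
             (λ (i , f , u∉H) → (i , f) , λ (_ , _ , _ , u∈H) → u∉H u∈H)
      ∘ Equivalence.to (forces v u))
    (Equivalence.from (forces v u)
      ∘ Sum.map (λ (i , p) → i , ≤fromℕ (suc i) , p)
                (λ ((i , f) , ¬p) → i , f , λ u∈H → ¬p (i , force-into-bundle 𝓕 x f u∈H)))
  where
  𝓕′ : RelaxedChronology G (Term 𝓕 x)
  𝓕′ = relabel (proj₁ (reversal 𝓕 x (fromℕ (K 𝓕)))) (active≐term 𝓕 x)

  forces = proj₂ (reversal 𝓕 x (fromℕ (K 𝓕)))
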